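{- Let $L$ be a complete lattice. The following implications hold: (1) $L\cong\operatorname{Pairs}(\to)$ for some two-acyclic factorization system $(S,\to,\twoheadrightarrow,\hookrightarrow)$ if and only if $L$ is a well separated $\kappa$-lattice. (2) If $L$ is a well separated $\kappa$-lattice then $L$ is a $\kappa$-lattice. (3) If $L\cong\operatorname{Pairs}(\to)$ for some two-acyclic factorization system, then joins and meets in $L$ are cover-determined. (4) If joins and meets in $L$ are cover-determined, then $L$ is weakly atomic. (5) If $L$ is a $\kappa$-lattice then $L$ is bi-spatial. (6) If $L$ is bi-algebraic, then joins and meets in $L$ are cover-determined. (7) If $L$ is bi-algebraic, then $L$ is bi-spatial. Under the additional hypothesis that $L$ is completely semidistributive, the following implications also hold: (8) If joins and meets in $L$ are cover-determined, then $L\cong\operatorname{Pairs}(\to)$ for some two-acyclic factorization system. (9) If $L$ is weakly atomic then $L$ is bi-spatial. (10) If $L$ is bi-spatial then $L$ is a $\kappa$-lattice.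
   Context: Lattices: A complete lattice is a poset in which every subset has a meet and a join. $x\lessdot y$ means $y$ covers $x$. An element $j$ of a complete lattice $L$ is completely join-irreducible if $j=\bigvee X$ implies $j\in X$ for all $X\subseteq L$; equivalently there is $j_*$ such that $x<j$ iff $x\le j_*$. Dually, $m$ is completely meet-irreducible if $m=\bigwedge X$ implies $m\in X$; equivalently there is $m^*$ with $x>m$ iff $x\ge m^*$. $\operatorname{Ji}^cL$, $\operatorname{Mi}^cL$ denote the sets of such elements. $L$ is bi-spatial if every $x\in L$ equals $\bigvee\{j\in\operatorname{Ji}^cL: j\le x\}$ and $\bigwedge\{m\in\operatorname{Mi}^cL: m\ge x\}$. A $\kappa$-lattice is a complete, bi-spatial lattice $L$ for which there are inverse bijections $\kappa:\operatorname{Ji}^cL\to\operatorname{Mi}^cL$ and $\kappa^d:\operatorname{Mi}^cL\to\operatorname{Ji}^cL$ such that $\kappa(j)$ is the maximum element of $\{y: j\wedge y=j_*\}$ and $\kappa^d(m)$ is the minimum element of $\{x: m\vee x=m^*\}$. A $\kappa$-lattice is well separated if whenever $z_1\not\le z_2$, there is $j\in\operatorname{Ji}^cL$ with $z_1\ge j$ and $\kappa(j)\ge z_2$. $L$ is weakly atomic if for all $x<y$ there exist $u,v$ with $x\le u\lessdot v\le y$. Meets in $L$ are cover-determined if whenever $x<y$ and $x\wedge z<y\wedge z$, there is a cover $u\lessdot v$ with $x\le u\lessdot v\le y$ and $u\wedge z<v\wedge z$; joins in $L$ are cover-determined if the dual condition holds (whenever $x<y$ and $x\vee z<y\vee z$,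 there is a cover with $x\le u\lessdot v\le y$ and $u\vee z<v\vee z$). An element $x$ is compact if for every $A\subseteq L$ with $\bigvee A\ge x$ there is a finite $F\subseteq A$ with $\bigvee F\ge x$; $L$ is algebraic if every element is the join of the compact elements below it; $L$ is bi-algebraic if $L$ and its dual are algebraic. A complete lattice is completely join semidistributive if for every nonempty $X\subseteq L$ and $y,z\in L$ with $x\vee y=z$ for all $x\in X$, one has $(\bigwedge X)\vee y=z$; completely meet semidistributive is the dual; completely semidistributive means both. Factorization systems: For a binary relation $\to$ on a set $S$ and $X\subseteq S$, put $X^\perp=\{y\in S: x\not\to y\ \forall x\in X\}$ and ${}^\perp X=\{y\in S: y\not\to x\ \forall x\in X\}$. A maximal orthogonal pair is a pair $(X,Y)$ of subsets of $S$ with $Y=X^\perp$ and $X={}^\perp Y$. $\operatorname{Pairs}(\to)$ is the set of maximal orthogonal pairs, partially ordered by containment of first components. For a reflexive relation $\to$ on $S$, $\operatorname{Fact}(\to)=(\twoheadrightarrow,\hookrightarrow)$, where $x\twoheadrightarrow y$ iff for all $z$, $y\to z$ implies $x\to z$, and $x\hookrightarrow y$ iff for all $z$, $z\to x$ implies $z\to y$. For preorders $\twoheadrightarrow,\hookrightarrow$ on $S$, $\operatorname{Mult}(\twoheadrightarrow,\hookrightarrow)$ is the relation relating $x$ to $z$ iff there is $y\in S$ with $x\twoheadrightarrow y\hookrightarrow z$. A factorization system is a tuple $(S,\to,\twoheadrightarrow,\hookrightarrow)$ ($S$ possibly infinite) with $\to$ reflexive, $\operatorname{Fact}(\to)=(\twoheadrightarrow,\hookrightarrow)$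 and $\operatorname{Mult}(\twoheadrightarrow,\hookrightarrow)=\to$. It is two-acyclic if $x\twoheadrightarrow y\twoheadrightarrow x$ implies $x=y$, $x\hookrightarrow y\hookrightarrow x$ implies $x=y$, and $x\twoheadrightarrow y\hookrightarrow x$ implies $x=y$. -}

module Defs where

open import Level using (Level; suc)
open import Data.List.Base using (List)
open import Data.List.Relation.Unary.All using (All)
import Data.List.Membership.Setoid as ListMembership
open import Data.Product.Base using (_×_; _,_; ∃; Σ; Σ-syntax; ∃-syntax; proj₁; proj₂)
open import Data.Sum.Base using (_⊎_)
open import Function.Base using (_∘_)
open import Function.Bundles using (Inverse; _⇔_; mk⇔)
open import Relation.Binary.Bundles using (Poset; Setoid)
open import Relation.Binary.Core as Binary using (Rel)
open import Relation.Binary.Definitions using (Reflexive; _Respects₂_)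
import Relation.Binary.Construct.NonStrictToStrict as ToStrict
import Relation.Binary.Construct.On as On
open import Relation.Binary.Morphism.Structures using (IsOrderIsomorphism)
import Relation.Binary.Properties.Poset as PosetProperties
open import Relation.Nullary.Negation using (¬_)
open import Relation.Unary using (Pred; _∈_; _⊆_; _≐_; Satisfiable)

-- Sets are setoids and subsets are predicates; under excluded middle predicates
-- can be moved between universe levels, so a single level ℓ serves for
-- carriers, relations, and the subsets that are quantified over.

module _ {a} (P : Poset a a a) where
  open Poset P

  IsChain : Pred Carrier a → Set a
  IsChain C = ∀ {x y} → x ∈ C → y ∈ C → x ≤ y ⊎ y ≤ x

  IsMaximal : Carrier → Set a
  IsMaximal m = ∀ {x} → m ≤ x → x ≤ m

  HasUpperBound : Pred Carrier a → Set a
  HasUpperBound C = ∃[ u ] (∀ {x} → x ∈ C → x ≤ u)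

-- Together with ExcludedMiddle this supplies the classical set theory (ZFC) in
-- which the results are meant. The empty chain is included, so the poset is nonempty.
ZornsLemma : ∀ a → Set (suc a)
ZornsLemma a = (P : Poset a a a) →
  (∀ C → IsChain P C → HasUpperBound P C) → ∃ (IsMaximal P)

module _ {a} (P : Poset a a a) where
  open Poset P

  IsJoin : ∀ {p} → Pred Carrier p → Carrier → Set _
  IsJoin X u = (∀ {x} → x ∈ X → x ≤ u) × (∀ v → (∀ {x} → x ∈ X → x ≤ v) → u ≤ v)

  IsMeet : ∀ {p} → Pred Carrier p → Carrier → Set _
  IsMeet X u = (∀ {x} → x ∈ X → u ≤ x) × (∀ v → (∀ {x} → x ∈ X → v ≤ x) → v ≤ u)

  IsMaximum : ∀ {p} → Pred Carrier p → Carrier → Set _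
  IsMaximum X m = m ∈ X × (∀ {x} → x ∈ X → x ≤ m)

  IsMinimum : ∀ {p} → Pred Carrier p → Carrier → Set _
  IsMinimum X m = m ∈ X × (∀ {x} → x ∈ X → m ≤ x)

record CompleteLattice ℓ : Set (suc ℓ) where
  infix 4 _⋖_
  infixr 6 _∨_
  infixr 7 _∧_
  field
    poset  : Poset ℓ ℓ ℓ

  open Poset poset public

  field
    ⋁      : Pred Carrier ℓ → Carrier
    ⋀      : Pred Carrier ℓ → Carrier
    ⋁-join : ∀ X → IsJoin poset X (⋁ X)
    ⋀-meet : ∀ X → IsMeet poset X (⋀ X)

  open ToStrict _≈_ _≤_ public using (_<_)

  _∨_ : Carrier → Carrier → Carrier
  x ∨ y = ⋁ (λ z → z ≈ x ⊎ z ≈ y)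

  _∧_ : Carrier → Carrier → Carrier
  x ∧ y = ⋀ (λ z → z ≈ x ⊎ z ≈ y)

  _⋖_ : Rel Carrier ℓ
  x ⋖ y = x < y × ¬ (∃[ z ] (x < z × z < y))

  -- A predicate need not respect _≈_, so this is membership up to _≈_.
  _∈≈_ : Carrier → Pred Carrier ℓ → Set ℓ
  x ∈≈ X = ∃[ y ] (y ∈ X × x ≈ y)

dual : ∀ {ℓ} → CompleteLattice ℓ → CompleteLattice ℓ
dual L = record
  { poset  = PosetProperties.≥-poset poset
  ; ⋁      = ⋀
  ; ⋀      = ⋁
  ; ⋁-join = ⋀-meet
  ; ⋀-meet = ⋁-join
  }
  where open CompleteLattice L

module _ {ℓ} (L : CompleteLattice ℓ) where
  open CompleteLattice L

  IsCompletelyJoinIrreducible : Carrier → Set (suc ℓ)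
  IsCompletelyJoinIrreducible j = ∀ X → j ≈ ⋁ X → j ∈≈ X

  IsCompletelyMeetIrreducible : Carrier → Set (suc ℓ)
  IsCompletelyMeetIrreducible m = ∀ X → m ≈ ⋀ X → m ∈≈ X

  Jiᶜ : Setoid (suc ℓ) ℓ
  Jiᶜ = On.setoid Eq.setoid (proj₁ {B = IsCompletelyJoinIrreducible})

  Miᶜ : Setoid (suc ℓ) ℓ
  Miᶜ = On.setoid Eq.setoid (proj₁ {B = IsCompletelyMeetIrreducible})

  -- j_* and m^*; see lowerStar-spec and upperStar-spec.
  lowerStar : Carrier → Carrier
  lowerStar j = ⋁ (λ x → x < j)

  upperStar : Carrier → Carrier
  upperStar m = ⋀ (λ x → m < x)

  lowerStar-spec : ∀ {j} → IsCompletelyJoinIrreducible j →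
                   ∀ x → x < j ⇔ x ≤ lowerStar j
  lowerStar-spec {j} ji x = mk⇔ (proj₁ (⋁-join _)) λ x≤j* →
    trans x≤j* j*≤j , λ x≈j →
      let (y , (_ , y≉j) , j≈y) = ji _ (antisym (trans (reflexive (Eq.sym x≈j)) x≤j*) j*≤j)
      in y≉j (Eq.sym j≈y)
    where
    j*≤j : lowerStar j ≤ j
    j*≤j = proj₂ (⋁-join _) j proj₁

  upperStar-spec : ∀ {m} → IsCompletelyMeetIrreducible m →
                   ∀ x → m < x ⇔ upperStar m ≤ x
  upperStar-spec {m} mi x = mk⇔ (proj₁ (⋀-meet _)) λ m*≤x →
    trans m≤m* m*≤x , λ m≈x →
      let (y , (_ , m≉y) , m≈y) = mi _ (antisym m≤m* (trans m*≤x (reflexive (Eq.sym m≈x))))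
      in m≉y m≈y
    where
    m≤m* : m ≤ upperStar m
    m≤m* = proj₂ (⋀-meet _) m proj₁

  record IsBiSpatial : Set (suc ℓ) where
    field
      join-of-Jiᶜ : ∀ x → IsJoin poset (λ j → IsCompletelyJoinIrreducible j × j ≤ x) x
      meet-of-Miᶜ : ∀ x → IsMeet poset (λ m → IsCompletelyMeetIrreducible m × x ≤ m) x

  record IsκLattice : Set (suc ℓ) where
    field
      isBiSpatial : IsBiSpatial
      κ-inverse   : Inverse Jiᶜ Miᶜ

    open Inverse κ-inverse public using () renaming (to to κ; from to κᵈ)

    field
      κ-maximum  : ∀ j → IsMaximum poset
                     (λ y → proj₁ j ∧ y ≈ lowerStar (proj₁ j)) (proj₁ (κ j))
      κᵈ-minimum : ∀ m → IsMinimum poset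
                     (λ x → proj₁ m ∨ x ≈ upperStar (proj₁ m)) (proj₁ (κᵈ m))

  IsWellSeparated : IsκLattice → Set (suc ℓ)
  IsWellSeparated isκ = ∀ {z₁ z₂} → ¬ (z₁ ≤ z₂) →
    Σ[ j ∈ Setoid.Carrier Jiᶜ ] (proj₁ j ≤ z₁ × z₂ ≤ proj₁ (κ j))
    where open IsκLattice isκ

  IsWellSeparatedκLattice : Set (suc ℓ)
  IsWellSeparatedκLattice = Σ IsκLattice IsWellSeparated

  IsWeaklyAtomic : Set ℓ
  IsWeaklyAtomic = ∀ {x y} → x < y → ∃[ u ] ∃[ v ] (x ≤ u × u ⋖ v × v ≤ y)

  MeetsCoverDetermined : Set ℓ
  MeetsCoverDetermined = ∀ {x y z} → x < y → (x ∧ z) < (y ∧ z) →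
    ∃[ u ] ∃[ v ] (x ≤ u × u ⋖ v × v ≤ y × (u ∧ z) < (v ∧ z))

  JoinsCoverDetermined : Set ℓ
  JoinsCoverDetermined = ∀ {x y z} → x < y → (x ∨ z) < (y ∨ z) →
    ∃[ u ] ∃[ v ] (x ≤ u × u ⋖ v × v ≤ y × (u ∨ z) < (v ∨ z))

  JoinsAndMeetsCoverDetermined : Set ℓ
  JoinsAndMeetsCoverDetermined = JoinsCoverDetermined × MeetsCoverDetermined

  IsCompact : Carrier → Set (suc ℓ)
  IsCompact x = ∀ (A : Pred Carrier ℓ) → x ≤ ⋁ A →
    Σ[ F ∈ List Carrier ] (All A F × x ≤ ⋁ (_∈ₗ F))
    where open ListMembership Eq.setoid using () renaming (_∈_ to _∈ₗ_)

  IsAlgebraic : Set (suc ℓ)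
  IsAlgebraic = ∀ x → IsJoin poset (λ k → IsCompact k × k ≤ x) x

  IsCompletelyJoinSemidistributive : Set (suc ℓ)
  IsCompletelyJoinSemidistributive = ∀ (X : Pred Carrier ℓ) y z → Satisfiable X →
    (∀ {x} → x ∈ X → x ∨ y ≈ z) → ⋀ X ∨ y ≈ z

module _ {ℓ} (L : CompleteLattice ℓ) where

  IsBiAlgebraic : Set (suc ℓ)
  IsBiAlgebraic = IsAlgebraic L × IsAlgebraic (dual L)

  IsCompletelyMeetSemidistributive : Set (suc ℓ)
  IsCompletelyMeetSemidistributive = IsCompletelyJoinSemidistributive (dual L)

  IsCompletelySemidistributive : Set (suc ℓ)
  IsCompletelySemidistributive =
    IsCompletelyJoinSemidistributive L × IsCompletelyMeetSemidistributive

module _ {ℓ} {S : Set ℓ} where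

  rightPerp : Rel S ℓ → Pred S ℓ → Pred S ℓ
  rightPerp _⟶_ X y = ∀ {x} → x ∈ X → ¬ (x ⟶ y)

  leftPerp : Rel S ℓ → Pred S ℓ → Pred S ℓ
  leftPerp _⟶_ X y = ∀ {x} → x ∈ X → ¬ (y ⟶ x)

  Fact↠ : Rel S ℓ → Rel S ℓ
  Fact↠ _⟶_ x y = ∀ z → y ⟶ z → x ⟶ z

  Fact↪ : Rel S ℓ → Rel S ℓ
  Fact↪ _⟶_ x y = ∀ z → z ⟶ x → z ⟶ y

  Mult : Rel S ℓ → Rel S ℓ → Rel S ℓ
  Mult _↠_ _↪_ x z = ∃[ y ] (x ↠ y × y ↪ z)

  record MaximalOrthogonalPair (_⟶_ : Rel S ℓ) : Set (suc ℓ) where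
    field
      X  : Pred S ℓ
      Y  : Pred S ℓ
      Y≐ : Y ≐ rightPerp _⟶_ X
      X≐ : X ≐ leftPerp _⟶_ Y

  Pairs : Rel S ℓ → Poset (suc ℓ) ℓ ℓ
  Pairs _⟶_ = record
    { Carrier = MaximalOrthogonalPair _⟶_
    ; _≈_     = λ p q → X p ≐ X q × Y p ≐ Y q
    ; _≤_     = λ p q → X p ⊆ X q
    ; isPartialOrder = record
      { isPreorder = record
        { isEquivalence = record
          { refl  = ((λ x → x) , (λ x → x)) , ((λ x → x) , (λ x → x))
          ; sym   = λ ((a , b) , (c , d)) → (b , a) , (d , c)
          ; trans = λ ((a , b) , (c , d)) ((a′ , b′) , (c′ , d′)) →
                      (a′ ∘ a , b ∘ b′) , (c′ ∘ c , d ∘ d′)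
          }
        ; reflexive = λ p≈q → proj₁ (proj₁ p≈q)
        ; trans     = λ f g → g ∘ f
        }
      ; antisym = λ {p} {q} f g → (f , g) , (Y-antitone q p g , Y-antitone p q f)
      }
    }
    where
    open MaximalOrthogonalPair
    Y-antitone : ∀ p q → X p ⊆ X q → Y q ⊆ Y p
    Y-antitone p q Xp⊆Xq y∈Yq =
      proj₂ (Y≐ p) (λ x∈Xp → proj₁ (Y≐ q) y∈Yq (Xp⊆Xq x∈Xp))

-- Since ↠ and ↪ are determined by ⟶, they respect the equality of S
-- once ⟶ does.
record FactorizationSystem ℓ : Set (suc ℓ) where
  infix 4 _⟶_ _↠_ _↪_
  field
    S : Setoid ℓ ℓ

  open Setoid S public

  field
    _⟶_    : Rel Carrier ℓ
    _↠_    : Rel Carrier ℓ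
    _↪_    : Rel Carrier ℓ
    ⟶-resp : _⟶_ Respects₂ _≈_
    ⟶-refl : Reflexive _⟶_
    fact↠  : Fact↠ _⟶_ Binary.⇔ _↠_
    fact↪  : Fact↪ _⟶_ Binary.⇔ _↪_
    mult   : Mult _↠_ _↪_ Binary.⇔ _⟶_

record IsTwoAcyclic {ℓ} (F : FactorizationSystem ℓ) : Set ℓ where
  open FactorizationSystem F
  field
    ↠-acyclic  : ∀ {x y} → x ↠ y → y ↠ x → x ≈ y
    ↪-acyclic  : ∀ {x y} → x ↪ y → y ↪ x → x ≈ y
    ↠↪-acyclic : ∀ {x y} → x ↠ y → y ↪ x → x ≈ y

infix 4 _≅_
_≅_ : ∀ {a b c d e f} → Poset a b c → Poset d e f → Set _
P ≅ Q = ∃[ f ] IsOrderIsomorphism P._≈_ Q._≈_ P._≤_ Q._≤_ f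
  where
  module P = Poset P
  module Q = Poset Q

IsPairsOfTwoAcyclic : ∀ {ℓ} → CompleteLattice ℓ → Set (suc ℓ)
IsPairsOfTwoAcyclic {ℓ} L = Σ[ F ∈ FactorizationSystem ℓ ]
  (IsTwoAcyclic F × CompleteLattice.poset L ≅ Pairs (FactorizationSystem._⟶_ F))

{-# OPTIONS --safe #-}

-- Both sides of (1) amount to a family of pairs (J s, M s) with M s = κ(J s) such that
-- every x ≰ y is separated by some s with J s ≤ x and y ≤ M s; the relation is then
-- s ⟶ t iff J s ≰ M t, and J s, M t are the pairs generated by {s} on the left and by {t}
-- on the right. That M = κ(J) has a formulation symmetric under passing to the dual
-- lattice, so most arguments are made for one half only. In the algebraic case covers come
-- from Zorn's lemma: an element maximal among those not above a compact k is covered by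
-- its join with k. In the semidistributive case a cover u ⋖ w is labelled by the
-- join-irreducible j = ⋀ {t : t ∨ u = w}, and κ(j) = ⋁ {y : y ∧ j = j⁎}.
module Submission where

open import Defs
open import Axiom.DoubleNegationElimination using (DoubleNegationElimination; em⇒dne)
open import Axiom.ExcludedMiddle using (ExcludedMiddle)
open import Data.List.Relation.Unary.All using (All; []; _∷_)
open import Data.List.Relation.Unary.Any using (here; there)
import Data.List.Membership.Setoid as ListMembership
open import Data.Product.Base using (_×_; _,_; ∃-syntax; Σ; Σ-syntax; proj₁; proj₂; swap)
open import Data.Sum.Base using (_⊎_; inj₁; inj₂)
open import Data.Unit.Polymorphic.Base using (⊤)
open import Function.Base using (id; _∘_)
open import Function.Bundles using (_⇔_; mk⇔; Equivalence; Inverse)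
open import Level using (Lift; lift; lower; suc)
open import Relation.Binary.Bundles using (Poset; Setoid)
import Relation.Binary.Construct.On as On
open import Relation.Binary.Core using (Rel)
open import Relation.Binary.Morphism.Structures using (IsOrderIsomorphism)
open import Relation.Nullary.Decidable.Core using (True; toWitness; fromWitness; yes; no)
open import Relation.Nullary.Negation.Core using (¬_)
open import Relation.Unary using (Pred; _∈_; _⊆_)

-- Order-theoretic preliminaries and duality

module _ {ℓ} (L : CompleteLattice ℓ) where
  open CompleteLattice L

  x≤x∨y : ∀ {x y} → x ≤ x ∨ y
  x≤x∨y = proj₁ (⋁-join _) (inj₁ Eq.refl)

  y≤x∨y : ∀ {x y} → y ≤ x ∨ y
  y≤x∨y = proj₁ (⋁-join _) (inj₂ Eq.refl)

  ∨-least : ∀ {x y z} → x ≤ z → y ≤ z → x ∨ y ≤ z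
  ∨-least x≤z y≤z = proj₂ (⋁-join _) _ λ where
    (inj₁ t≈x) → trans (reflexive t≈x) x≤z
    (inj₂ t≈y) → trans (reflexive t≈y) y≤z

  ∨-monoˡ : ∀ {x y z} → x ≤ y → x ∨ z ≤ y ∨ z
  ∨-monoˡ x≤y = ∨-least (trans x≤y x≤x∨y) y≤x∨y

  ≤∧≱⇒< : ∀ {x y} → x ≤ y → ¬ (y ≤ x) → x < y
  ≤∧≱⇒< x≤y y≰x = x≤y , λ x≈y → y≰x (reflexive (Eq.sym x≈y))

  <⇒≱ : ∀ {x y} → x < y → ¬ (y ≤ x)
  <⇒≱ (x≤y , x≉y) y≤x = x≉y (antisym x≤y y≤x)

  <-respʳ : ∀ {x y z} → x < y → y ≈ z → x < z
  <-respʳ (x≤y , x≉y) y≈z =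
    trans x≤y (reflexive y≈z) , λ x≈z → x≉y (Eq.trans x≈z (Eq.sym y≈z))

  -- Passing to `dual L` is definitional for `≤`, `∨` and `∧`, but not for `<`, whose negated
  -- equality swaps its sides.
  <-dual : ∀ {x y} → x < y → CompleteLattice._<_ (dual L) y x
  <-dual (x≤y , x≉y) = x≤y , λ y≈x → x≉y (Eq.sym y≈x)

  -- For completely join-irreducible j, the elements y in the last clause are those with j ∧ y = j⁎,
  -- so m is κ(j). Only the order is mentioned, and the first two clauses already force j to be
  -- irreducible.
  IsκImage : Carrier → Carrier → Set ℓ
  IsκImage j m =
    ¬ (j ≤ m) ×
    (∀ {x} → x < j → x ≤ m) ×
    (∀ {y} → (∀ {x} → x < j → x ≤ y) → ¬ (j ≤ y) → y ≤ m)

  IsκImage-resp : ∀ {j j′ m m′} → j ≈ j′ → m ≈ m′ → IsκImage j m → IsκImage j′ m′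
  IsκImage-resp j≈j′ m≈m′ (j≰m , below , max) =
    (λ j′≤m′ → j≰m (trans (reflexive j≈j′)
                     (trans j′≤m′ (reflexive (Eq.sym m≈m′))))) ,
    (λ x<j′ → trans (below (<-respʳ x<j′ (Eq.sym j≈j′))) (reflexive m≈m′)) ,
    (λ ub j′≰y → trans (max (λ x<j → ub (<-respʳ x<j j≈j′))
                             (λ j≤y → j′≰y (trans (reflexive (Eq.sym j≈j′)) j≤y)))
                       (reflexive m≈m′))

  IsκImage-≤ : ∀ {j m m′} → IsκImage j m → IsκImage j m′ → m ≤ m′
  IsκImage-≤ (j≰m , below , _) (_ , _ , max′) = max′ below j≰m

  IsκImage-unique : ∀ {j j′ m m′} → j ≈ j′ → IsκImage j m → IsκImage j′ m′ → m ≈ m′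
  IsκImage-unique j≈j′ p p′ =
    antisym (IsκImage-≤ (IsκImage-resp j≈j′ Eq.refl p) p′)
            (IsκImage-≤ p′ (IsκImage-resp j≈j′ Eq.refl p))

  ⋖-dual : ∀ {x y} → CompleteLattice._⋖_ (dual L) y x → x ⋖ y
  ⋖-dual (y<x , ∄) =
    (proj₁ y<x , λ x≈y → proj₂ y<x (Eq.sym x≈y)) ,
    λ (z , x<z , z<y) → ∄ (z , <-dual z<y , <-dual x<z)

module _ {ℓ} (L : CompleteLattice ℓ) where
  open CompleteLattice L

  x∧y≤x : ∀ {x y} → x ∧ y ≤ x
  x∧y≤x = x≤x∨y (dual L)

  x∧y≤y : ∀ {x y} → x ∧ y ≤ y
  x∧y≤y = y≤x∨y (dual L)

  ∧-greatest : ∀ {x y z} → z ≤ x → z ≤ y → z ≤ x ∧ y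
  ∧-greatest = ∨-least (dual L)

  ∧-monoˡ : ∀ {x y z} → x ≤ y → x ∧ z ≤ y ∧ z
  ∧-monoˡ = ∨-monoˡ (dual L)

  -- For j completely join-irreducible and m completely meet-irreducible this
  -- says m = κ(j) and j = κᵈ(m).
  κ-Paired : Carrier → Carrier → Set ℓ
  κ-Paired j m = IsκImage L j m × IsκImage (dual L) m j

  κ-Paired-resp : ∀ {j j′ m m′} → j ≈ j′ → m ≈ m′ → κ-Paired j m → κ-Paired j′ m′
  κ-Paired-resp j≈j′ m≈m′ (p , q) =
    IsκImage-resp L j≈j′ m≈m′ p , IsκImage-resp (dual L) m≈m′ j≈j′ q

  joinsCoverDetermined : MeetsCoverDetermined (dual L) → JoinsCoverDetermined L
  joinsCoverDetermined mcd x<y xz<yz =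
    let (u , v , y≥u , u⋗v , v≥x , vz<uz) = mcd (<-dual L x<y) (<-dual L xz<yz)
    in v , u , v≥x , ⋖-dual L u⋗v , y≥u , <-dual (dual L) vz<uz

  -- The choice z = y works because x ∧ y = x and y ∧ y = y.
  isWeaklyAtomic : MeetsCoverDetermined L → IsWeaklyAtomic L
  isWeaklyAtomic mcd {x} {y} x<y =
    let (u , v , x≤u , u⋖v , v≤y , _) = mcd {z = y} x<y
          (≤∧≱⇒< L (∧-monoˡ (proj₁ x<y))
                   (λ yy≤xy → <⇒≱ L x<y (trans (∧-greatest refl refl) (trans yy≤xy x∧y≤x))))
    in u , v , x≤u , u⋖v , v≤y

  isWeaklyAtomic-dual : IsWeaklyAtomic L → IsWeaklyAtomic (dual L)
  isWeaklyAtomic-dual wa y<x =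
    let (u , v , x≤u , (u<v , ∄) , v≤y) = wa (<-dual (dual L) y<x)
    in v , u , v≤y ,
       (<-dual L u<v , λ (z , v<z , z<u) → ∄ (z , <-dual (dual L) z<u , <-dual (dual L) v<z)) ,
       x≤u

-- Separating families

-- The index set is at level ℓ, as the underlying set of a factorization system must be, whereas the
-- completely irreducible elements form a type at level suc ℓ. Irreducibility follows from `paired`.
record SeparatingFamily {ℓ} (L : CompleteLattice ℓ) : Set (suc ℓ) where
  open CompleteLattice L
  field
    Index     : Set ℓ
    J         : Index → Carrier
    M         : Index → Carrier
    paired    : ∀ s → κ-Paired L (J s) (M s)
    separates : ∀ {x y} → ¬ (x ≤ y) → ∃[ s ] (J s ≤ x × y ≤ M s)

  J≰M : ∀ {s} → ¬ (J s ≤ M s)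
  J≰M {s} = proj₁ (proj₁ (paired s))

dualFamily : ∀ {ℓ} {L : CompleteLattice ℓ} → SeparatingFamily L → SeparatingFamily (dual L)
dualFamily F = record
  { J         = M
  ; M         = J
  ; paired    = swap ∘ paired
  ; separates = λ x≱y → let (s , J≤ , ≤M) = separates x≱y in s , ≤M , J≤
  }
  where open SeparatingFamily F

-- Complete irreducibility and the maps κ and κᵈ

module _ (em : ∀ {a} → ExcludedMiddle a) where

  dne : ∀ {a} → DoubleNegationElimination a
  dne = em⇒dne em

  -- Excluded middle gives propositional resizing.
  Resize : ∀ {a} b → Set a → Set b
  Resize b P = Lift b (True (em {P = P}))

  module _ {ℓ} (L : CompleteLattice ℓ) where
    open CompleteLattice L

    -- If j = ⋁ X and j were not in X, all members of X would be strictly below j, hence below m,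
    -- and so j ≤ m.
    isCompletelyJoinIrreducible : ∀ {j m} → ¬ (j ≤ m) → (∀ {x} → x < j → x ≤ m) →
                                  IsCompletelyJoinIrreducible L j
    isCompletelyJoinIrreducible j≰m below X j≈⋁X = dne λ j∉X →
      j≰m (trans (reflexive j≈⋁X) (proj₂ (⋁-join X) _ λ {x} x∈X → below
        (trans (proj₁ (⋁-join X) x∈X) (reflexive (Eq.sym j≈⋁X)) ,
         λ x≈j → j∉X (x , x∈X , Eq.sym x≈j))))

    module _ {j e m : Carrier} (e<j : e < j) (j⁎≤e : ∀ {x} → x < j → x ≤ e) where

      -- Here e plays the role of j⁎, so j ∧ y = e says just that e ≤ y and j ≰ y.
      maximum⇒κ : IsMaximum poset (λ y → j ∧ y ≈ e) m → IsκImage L j m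
      maximum⇒κ (jm≈e , max) =
        (λ j≤m → <⇒≱ L e<j (trans (∧-greatest L refl j≤m) (reflexive jm≈e))) ,
        (λ x<j → trans (j⁎≤e x<j) (trans (reflexive (Eq.sym jm≈e)) (x∧y≤y L))) ,
        (λ ub j≰y → max (antisym
          (j⁎≤e (≤∧≱⇒< L (x∧y≤x L) (λ j≤jy → j≰y (trans j≤jy (x∧y≤y L)))))
          (∧-greatest L (proj₁ e<j) (ub e<j))))

      κ⇒maximum : IsκImage L j m → IsMaximum poset (λ y → j ∧ y ≈ e) m
      κ⇒maximum (j≰m , below , max) =
        antisym (j⁎≤e (≤∧≱⇒< L (x∧y≤x L) (λ j≤jm → j≰m (trans j≤jm (x∧y≤y L)))))
                (∧-greatest L (proj₁ e<j) (below e<j)) ,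
        λ jy≈e → max (λ x<j → trans (j⁎≤e x<j) (trans (reflexive (Eq.sym jy≈e)) (x∧y≤y L)))
                     (λ j≤y → <⇒≱ L e<j (trans (∧-greatest L refl j≤y) (reflexive jy≈e)))

    lowerStar-< : ∀ {j} → IsCompletelyJoinIrreducible L j → lowerStar L j < j
    lowerStar-< ji = Equivalence.from (lowerStar-spec L ji _) refl

    <⇒≤lowerStar : ∀ {j} → IsCompletelyJoinIrreducible L j → ∀ {x} → x < j → x ≤ lowerStar L j
    <⇒≤lowerStar ji = Equivalence.to (lowerStar-spec L ji _)

    upperStar-> : ∀ {m} → IsCompletelyMeetIrreducible L m →
                  CompleteLattice._<_ (dual L) (upperStar L m) m
    upperStar-> mi = <-dual L (Equivalence.from (upperStar-spec L mi _) refl)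

    >⇒≥upperStar : ∀ {m} → IsCompletelyMeetIrreducible L m →
                   ∀ {x} → CompleteLattice._<_ (dual L) x m → upperStar L m ≤ x
    >⇒≥upperStar mi x<m = Equivalence.to (upperStar-spec L mi _) (<-dual (dual L) x<m)

  module _ {ℓ} (L : CompleteLattice ℓ) where
    open CompleteLattice L

    pairedʲ : ∀ {j m} → κ-Paired L j m → IsCompletelyJoinIrreducible L j
    pairedʲ ((j≰m , below , _) , _) = isCompletelyJoinIrreducible L j≰m below

    pairedᵐ : ∀ {j m} → κ-Paired L j m → IsCompletelyMeetIrreducible L m
    pairedᵐ (_ , (m≱j , above , _)) = isCompletelyJoinIrreducible (dual L) m≱j above

    κ-paired : (K : IsκLattice L) → ∀ j → κ-Paired L (proj₁ j) (proj₁ (IsκLattice.κ K j))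
    κ-paired K j@(_ , ji) =
      maximum⇒κ L (lowerStar-< L ji) (<⇒≤lowerStar L ji) (κ-maximum j) ,
      -- `κᵈ-minimum` concerns κᵈ(κ(j)), which the inverse law identifies with j.
      IsκImage-resp (dual L) Eq.refl (Inverse.strictlyInverseʳ κ-inverse j)
        (maximum⇒κ (dual L) (upperStar-> L mi) (>⇒≥upperStar L mi) (κᵈ-minimum (κ j)))
      where
      open IsκLattice K
      mi : IsCompletelyMeetIrreducible L (proj₁ (κ j))
      mi = proj₂ (κ j)

    -- Either member of a pair determines the other by `IsκImage-unique`; this gives congruence and
    -- the inverse laws whichever partners were chosen.
    isκLattice : IsBiSpatial L →
                 (∀ j → IsCompletelyJoinIrreducible L j → ∃[ m ] κ-Paired L j m) →
                 (∀ m → IsCompletelyMeetIrreducible L m → ∃[ j ] κ-Paired L j m) →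
                 IsκLattice L
    isκLattice spatial κ κᵈ = record
      { isBiSpatial = spatial
      ; κ-inverse   = record
        { to        = λ (j , ji) → let (m , p) = κ j ji in m , pairedᵐ p
        ; from      = λ (m , mi) → let (j , p) = κᵈ m mi in j , pairedʲ p
        ; to-cong   = λ {(j , ji)} {(j′ , ji′)} j≈j′ →
            IsκImage-unique L j≈j′ (proj₁ (proj₂ (κ j ji))) (proj₁ (proj₂ (κ j′ ji′)))
        ; from-cong = λ {(m , mi)} {(m′ , mi′)} m≈m′ →
            IsκImage-unique (dual L) m≈m′ (proj₂ (proj₂ (κᵈ m mi))) (proj₂ (proj₂ (κᵈ m′ mi′)))
        ; inverse   =
            (λ {(m , mi)} {(j , ji)} j≈ →
              IsκImage-unique L j≈ (proj₁ (proj₂ (κ j ji))) (proj₁ (proj₂ (κᵈ m mi)))) ,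
            (λ {(j , ji)} {(m , mi)} m≈ →
              IsκImage-unique (dual L) m≈ (proj₂ (proj₂ (κᵈ m mi))) (proj₂ (proj₂ (κ j ji))))
        }
      ; κ-maximum  = λ (j , ji) →
          κ⇒maximum L (lowerStar-< L ji) (<⇒≤lowerStar L ji) (proj₁ (proj₂ (κ j ji)))
      ; κᵈ-minimum = λ (m , mi) →
          κ⇒maximum (dual L) (upperStar-> L mi) (>⇒≥upperStar L mi) (proj₂ (proj₂ (κᵈ m mi)))
      }

  -- Consequences of a separating family

  module _ {ℓ} {L : CompleteLattice ℓ} (F : SeparatingFamily L) where
    open CompleteLattice L
    open SeparatingFamily F

    -- An s separating x from v would satisfy J s ≤ x, hence J s ≤ v ≤ M s. Thus x is the join of
    -- the J s below it.
    join-of-J : ∀ {x v} → (∀ {s} → J s ≤ x → J s ≤ v) → x ≤ v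
    join-of-J ub = dne λ x≰v →
      let (s , Js≤x , v≤Ms) = separates x≰v in J≰M (trans (ub Js≤x) v≤Ms)

    family-join-of-Jiᶜ : ∀ x → IsJoin poset (λ j → IsCompletelyJoinIrreducible L j × j ≤ x) x
    family-join-of-Jiᶜ x = proj₂ , λ v ub → join-of-J λ {s} Js≤x → ub (pairedʲ L (paired s) , Js≤x)

    family-Jiᶜ : ∀ j → IsCompletelyJoinIrreducible L j → ∃[ s ] j ≈ J s
    family-Jiᶜ j ji =
      let (y , (s , y≈Js , _) , j≈y) = ji (λ y → ∃[ s ] (y ≈ J s × J s ≤ j))
            (antisym (join-of-J λ {s} Js≤j → proj₁ (⋁-join _) (s , Eq.refl , Js≤j))
                     (proj₂ (⋁-join _) j λ (_ , y≈Js , Js≤j) → trans (reflexive y≈Js) Js≤j))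
      in s , Eq.trans j≈y y≈Js

    -- If j separates y ∧ z from x, then (x ∨ j) ∧ κ(j) ⋖ x ∨ j.
    family⇒meetsCoverDetermined : MeetsCoverDetermined L
    family⇒meetsCoverDetermined {x} {y} {z} (x≤y , _) xz<yz
      with separates {y ∧ z} {x}
             (λ yz≤x → <⇒≱ L xz<yz (∧-greatest L yz≤x (x∧y≤y L)))
    ... | s , j≤yz , x≤m =
      u , v , ∧-greatest L (x≤x∨y L) x≤m ,
      (≤∧≱⇒< L (x∧y≤x L) (λ v≤u → J≰M (trans (y≤x∨y L) (trans v≤u (x∧y≤y L)))) , ∄) ,
      ∨-least L x≤y (trans j≤yz (x∧y≤x L)) ,
      ≤∧≱⇒< L (∧-monoˡ L (x∧y≤x L))
        (λ vz≤uz → J≰M (trans (∧-greatest L (y≤x∨y L) (trans j≤yz (x∧y≤y L)))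
                         (trans vz≤uz (trans (x∧y≤x L) (x∧y≤y L)))))
      where
      v u : Carrier
      v = x ∨ J s
      u = v ∧ M s
      ∄ : ¬ (∃[ w ] (u < w × w < v))
      -- If j ≤ w then v = x ∨ j ≤ w. Otherwise everything strictly below j is below u, hence below
      -- w, and maximality of κ(j) puts w under v ∧ κ(j) = u.
      ∄ (w , u<w , w<v) with em {P = J s ≤ w}
      ... | yes j≤w = <⇒≱ L w<v
        (∨-least L (trans (∧-greatest L (x≤x∨y L) x≤m) (proj₁ u<w)) j≤w)
      ... | no  j≰w = <⇒≱ L u<w (∧-greatest L (proj₁ w<v)
        (proj₂ (proj₂ (proj₁ (paired s)))
          (λ t<j → trans (∧-greatest L (trans (proj₁ t<j) (y≤x∨y L))
                                       (proj₁ (proj₂ (proj₁ (paired s))) t<j))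
                         (proj₁ u<w))
          j≰w))

  module _ {ℓ} {L : CompleteLattice ℓ} where
    open CompleteLattice L

    family⇒wellSeparated : SeparatingFamily L → IsWellSeparatedκLattice L
    family⇒wellSeparated F = K , λ z₁≰z₂ →
      let (s , Js≤z₁ , z₂≤Ms) = separates z₁≰z₂
          j = J s , pairedʲ L (paired s)
      -- `family-Jiᶜ` may have returned an index other than s, so M s is compared with the κ of `K`.
      in j , Js≤z₁ , trans z₂≤Ms (IsκImage-≤ L (proj₁ (paired s)) (proj₁ (κ-paired L K j)))
      where
      open SeparatingFamily F
      K : IsκLattice L
      K = isκLattice L
        (record { join-of-Jiᶜ = family-join-of-Jiᶜ F
                ; meet-of-Miᶜ = family-join-of-Jiᶜ (dualFamily F) })
        (λ j ji → let (s , j≈Js) = family-Jiᶜ F j ji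
                  in M s , κ-Paired-resp L (Eq.sym j≈Js) Eq.refl (paired s))
        (λ m mi → let (s , m≈Ms) = family-Jiᶜ (dualFamily F) m mi
                  in J s , κ-Paired-resp L Eq.refl (Eq.sym m≈Ms) (paired s))

    wellSeparated⇒family : IsWellSeparatedκLattice L → SeparatingFamily L
    wellSeparated⇒family (K , sep) = record
      { Index     = Σ[ j ∈ Carrier ] Resize ℓ (IsCompletelyJoinIrreducible L j)
      ; J         = proj₁
      ; M         = λ s → proj₁ (κ (irreducible s))
      ; paired    = λ s → κ-paired L K (irreducible s)
      ; separates = λ z₁≰z₂ →
          let ((j , ji) , j≤z₁ , z₂≤κj) = sep z₁≰z₂
              s = j , lift (fromWitness ji)
          -- The proof unpacked from s need not be `ji`, so κ is compared at two proofs of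
          -- irreducibility of the same j.
          in s , j≤z₁ , trans z₂≤κj
               (IsκImage-≤ L (proj₁ (κ-paired L K (j , ji)))
                             (proj₁ (κ-paired L K (irreducible s))))
      }
      where
      open IsκLattice K
      irreducible : Σ[ j ∈ Carrier ] Resize ℓ (IsCompletelyJoinIrreducible L j) →
                    Setoid.Carrier (Jiᶜ L)
      irreducible (j , r) = j , toWitness (lower r)

    family⇒coverDetermined : SeparatingFamily L → JoinsAndMeetsCoverDetermined L
    family⇒coverDetermined F =
      joinsCoverDetermined L (family⇒meetsCoverDetermined (dualFamily F)) ,
      family⇒meetsCoverDetermined F

  -- The factorization system of a separating family

  module _ {ℓ} {L : CompleteLattice ℓ} (F : SeparatingFamily L) where
    open CompleteLattice L
    open SeparatingFamily F

    private
      _⟶_ : Rel Index ℓ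
      s ⟶ t = ¬ (J s ≤ M t)

      J≤⇒↠ : ∀ {s t} → J t ≤ J s → Fact↠ _⟶_ s t
      J≤⇒↠ Jt≤Js _ t⟶z Js≤Mz = t⟶z (trans Jt≤Js Js≤Mz)

      -- A w separating J t from J s would satisfy t ⟶ w but not s ⟶ w.
      ↠⇒J≤ : ∀ {s t} → Fact↠ _⟶_ s t → J t ≤ J s
      ↠⇒J≤ s↠t = dne λ Jt≰Js →
        let (w , Jw≤Jt , Js≤Mw) = separates Jt≰Js
        in s↠t w (λ Jt≤Mw → J≰M (trans Jw≤Jt Jt≤Mw)) Js≤Mw

      M≤⇒↪ : ∀ {s t} → M t ≤ M s → Fact↪ _⟶_ s t
      M≤⇒↪ Mt≤Ms _ z⟶s Jz≤Mt = z⟶s (trans Jz≤Mt Mt≤Ms)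

      ↪⇒M≤ : ∀ {s t} → Fact↪ _⟶_ s t → M t ≤ M s
      ↪⇒M≤ s↪t = dne λ Mt≰Ms →
        let (w , Jw≤Mt , Ms≤Mw) = separates Mt≰Ms
        in s↪t w (λ Jw≤Ms → J≰M (trans Jw≤Ms Ms≤Mw)) Jw≤Mt

    -- Indices with the same J are identified, because acyclicity can only yield J s = J t; M then
    -- agrees by `IsκImage-unique`.
    familySystem : FactorizationSystem ℓ
    familySystem = record
      { S      = On.setoid Eq.setoid J
      ; _⟶_    = _⟶_
      ; _↠_    = Fact↠ _⟶_
      ; _↪_    = Fact↪ _⟶_
      ; ⟶-resp =
          (λ {_} {t} {t′} t≈t′ s⟶t Js≤Mt′ → s⟶t (trans Js≤Mt′ (reflexive (Eq.sym
            (IsκImage-unique L t≈t′ (proj₁ (paired t)) (proj₁ (paired t′))))))) ,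
          (λ s≈s′ s⟶t Js′≤Mt → s⟶t (trans (reflexive s≈s′) Js′≤Mt))
      ; ⟶-refl = J≰M
      ; fact↠  = id , id
      ; fact↪  = id , id
      ; mult   =
          (λ (w , s↠w , w↪t) → s↠w _ (w↪t w J≰M)) ,
          -- Separating J s from M t yields the middle term of s ↠ w ↪ t.
          (λ Js≰Mt → let (w , Jw≤Js , Mt≤Mw) = separates Js≰Mt
                      in w , J≤⇒↠ Jw≤Js , M≤⇒↪ Mt≤Mw)
      }

    familySystem-twoAcyclic : IsTwoAcyclic familySystem
    familySystem-twoAcyclic = record
      { ↠-acyclic  = λ s↠t t↠s → antisym (↠⇒J≤ t↠s) (↠⇒J≤ s↠t)
      ; ↪-acyclic  = λ {s} {t} s↪t t↪s →
          IsκImage-unique (dual L) (antisym (↪⇒M≤ t↪s) (↪⇒M≤ s↪t))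
            (proj₂ (paired s)) (proj₂ (paired t))
      -- If s ≉ t, then J t is strictly below J s, so J t ≤ M s ≤ M t.
      ; ↠↪-acyclic = λ {s} {t} s↠t t↪s → dne λ s≉t →
          J≰M (trans (proj₁ (proj₂ (proj₁ (paired s)))
                       (↠⇒J≤ s↠t , λ Jt≈Js → s≉t (Eq.sym Jt≈Js)))
                     (↪⇒M≤ t↪s))
      }

    family⇒pairs : IsPairsOfTwoAcyclic L
    family⇒pairs = familySystem , familySystem-twoAcyclic , pair , record
      { isOrderMonomorphism = record
        { isOrderHomomorphism = record
          { cong = λ {x} {y} x≈y → Pairs.antisym {pair x} {pair y}
                     (mono (reflexive x≈y)) (mono (reflexive (Eq.sym x≈y)))
          ; mono = λ {x} {y} x≤y → mono {x} {y} x≤y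
          }
        ; injective = λ ((X⊆ , X⊇) , _) → antisym (join-of-J F X⊆) (join-of-J F X⊇)
        ; cancel    = λ X⊆ → join-of-J F X⊆
        }
      -- Members t of X and b of Y satisfy J t ≤ M b, so `join p` is below M b for each b in Y. If J
      -- s is below `join p`, then s has no arrow into Y and so lies in X.
      ; surjective = λ p → join p , λ {x} x≈⋁ → Pairs.antisym {pair x} {p}
          (λ Js≤x → proj₂ (X≐ p) λ b∈Y Js⟶b →
            Js⟶b (trans Js≤x (trans (reflexive x≈⋁) (proj₂ (⋁-join _) _ λ (t , t∈X , y≈Jt) →
              trans (reflexive y≈Jt) (dne (proj₁ (Y≐ p) b∈Y t∈X))))))
          (λ {s} s∈X → trans (proj₁ (⋁-join _) (s , s∈X , Eq.refl)) (reflexive (Eq.sym x≈⋁)))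
      }
      where
      module Pairs = Poset (Pairs _⟶_)
      open MaximalOrthogonalPair

      pair : Carrier → MaximalOrthogonalPair _⟶_
      pair x = record
        { X  = λ s → J s ≤ x
        ; Y  = λ s → x ≤ M s
        ; Y≐ = (λ x≤Ms Jt≤x t⟶s → t⟶s (trans Jt≤x x≤Ms)) ,
               (λ s∈X⊥ → join-of-J F λ Jt≤x → dne (s∈X⊥ Jt≤x))
        ; X≐ = (λ Js≤x x≤Mt s⟶t → s⟶t (trans Js≤x x≤Mt)) ,
               (λ s∈⊥Y → join-of-J (dualFamily F) λ x≤Mt → dne (s∈⊥Y x≤Mt))
        }

      mono : ∀ {x y} → x ≤ y → X (pair x) ⊆ X (pair y)
      mono x≤y Js≤x = trans Js≤x x≤y

      join : MaximalOrthogonalPair _⟶_ → Carrier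
      join p = ⋁ (λ y → ∃[ s ] (s ∈ X p × y ≈ J s))

  -- From a two-acyclic factorization system to a separating family

  module _ {ℓ} (L : CompleteLattice ℓ) where
    open CompleteLattice L

    -- If x < J s but x ≰ M s, acyclicity applies to a separating t and forces J s = J t ≤ x. If J s
    -- ≰ y and y ≰ M s, a t separating J s from y has J t ≠ J s, so J t ≤ y ≤ M t. Keeping J and M
    -- arbitrary lets the dual case exchange them.
    acyclic⇒κ : {I : Set ℓ} (J M : I → Carrier) →
                (∀ {s} → ¬ (J s ≤ M s)) →
                (∀ {x y} → ¬ (x ≤ y) → ∃[ s ] (J s ≤ x × y ≤ M s)) →
                (∀ {s t} → J s ≈ J t → M s ≈ M t) →
                (∀ {s t} → J t ≤ J s → M s ≤ M t → J s ≈ J t) →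
                ∀ s → IsκImage L (J s) (M s)
    acyclic⇒κ J M J≰M separates J≈⇒M≈ acyclic s = J≰M ,
      (λ {x} x<Js → dne λ x≰Ms →
        let (t , Jt≤x , Ms≤Mt) = separates x≰Ms
        in <⇒≱ L x<Js (trans (reflexive (acyclic (trans Jt≤x (proj₁ x<Js)) Ms≤Mt)) Jt≤x)) ,
      (λ {y} ub Js≰y → dne λ y≰Ms →
        let (t , Jt≤Js , y≤Mt) = separates Js≰y
            Jt≉Js = λ Jt≈Js → y≰Ms (trans y≤Mt (reflexive (J≈⇒M≈ Jt≈Js)))
        in J≰M (trans (ub (Jt≤Js , Jt≉Js)) y≤Mt))

  module _ {ℓ} (L : CompleteLattice ℓ) where
    open CompleteLattice L

    pairs⇒family : IsPairsOfTwoAcyclic L → SeparatingFamily L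
    pairs⇒family (F , acyclic , f , iso) = record
      { J         = J
      ; M         = M
      ; paired    = λ s →
          acyclic⇒κ L J M J≰M separates
            (λ Js≈Jt → M-cong (↠-acyclic (J≤⇒↠ (reflexive (Eq.sym Js≈Jt)))
                                         (J≤⇒↠ (reflexive Js≈Jt))))
            (λ Jt≤Js Ms≤Mt → J-cong (↠↪-acyclic (J≤⇒↠ Jt≤Js) (M≤⇒↪ Ms≤Mt))) s ,
          acyclic⇒κ (dual L) M J J≰M
            (λ x≱y → let (t , Jt≤x , y≤Mt) = separates x≱y in t , y≤Mt , Jt≤x)
            (λ Ms≈Mt → J-cong (↪-acyclic (M≤⇒↪ (reflexive (Eq.sym Ms≈Mt)))
                                         (M≤⇒↪ (reflexive Ms≈Mt))))
            (λ Ms≤Mt Jt≤Js → M-cong (↠↪-acyclic (J≤⇒↠ Jt≤Js) (M≤⇒↪ Ms≤Mt))) s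
      ; separates = separates
      }
      where
      module F = FactorizationSystem F
      open F using (_⟶_; _↠_; _↪_)
      open IsTwoAcyclic acyclic
      open IsOrderIsomorphism iso using (mono; cancel; surjective)
      open MaximalOrthogonalPair

      -- The least pair with s in its first component; `s F.≈_` is the singleton of s.
      TorsionPair : F.Carrier → MaximalOrthogonalPair _⟶_
      TorsionPair s = record
        { X  = leftPerp _⟶_ (rightPerp _⟶_ (s F.≈_))
        ; Y  = rightPerp _⟶_ (s F.≈_)
        ; Y≐ = (λ b∈ t∈ → t∈ b∈) , (λ b∈ s≈t → b∈ λ c∈ → c∈ s≈t)
        ; X≐ = id , id
        }

      -- The greatest pair with s in its second component.
      TorsionFreePair : F.Carrier → MaximalOrthogonalPair _⟶_
      TorsionFreePair s = record
        { X  = leftPerp _⟶_ (s F.≈_)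
        ; Y  = rightPerp _⟶_ (leftPerp _⟶_ (s F.≈_))
        ; Y≐ = id , id
        ; X≐ = (λ b∈ t∈ → t∈ b∈) , (λ b∈ s≈t → b∈ λ c∈ → c∈ s≈t)
        }

      J M : F.Carrier → Carrier
      J s = proj₁ (surjective (TorsionPair s))
      M s = proj₁ (surjective (TorsionFreePair s))

      fJ : ∀ s → Poset._≈_ (Pairs _⟶_) (f (J s)) (TorsionPair s)
      fJ s = proj₂ (surjective (TorsionPair s)) Eq.refl

      fM : ∀ s → Poset._≈_ (Pairs _⟶_) (f (M s)) (TorsionFreePair s)
      fM s = proj₂ (surjective (TorsionFreePair s)) Eq.refl

      J≤⇒∈X : ∀ {s x} → J s ≤ x → s ∈ X (f x)
      J≤⇒∈X {s} Js≤x = mono Js≤x (proj₂ (proj₁ (fJ s)) λ b∈ → b∈ F.refl)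

      -- Leastness of the generated pair: no arrow leads from s into Y (f x), so anything orthogonal
      -- to all that s is orthogonal to lies in X (f x).
      ∈X⇒J≤ : ∀ {s x} → s ∈ X (f x) → J s ≤ x
      ∈X⇒J≤ {s} {x} s∈X = cancel λ t∈ → proj₂ (X≐ (f x)) λ b∈Y →
        proj₁ (proj₁ (fJ s)) t∈ λ s≈r r⟶b →
          proj₁ (X≐ (f x)) s∈X b∈Y (proj₂ F.⟶-resp (F.sym s≈r) r⟶b)

      ≤M⇒∈Y : ∀ {s x} → x ≤ M s → s ∈ Y (f x)
      ≤M⇒∈Y {s} {x} x≤Ms = proj₂ (Y≐ (f x)) λ t∈X →
        proj₁ (proj₁ (fM s)) (mono x≤Ms t∈X) F.refl

      ∈Y⇒≤M : ∀ {s x} → s ∈ Y (f x) → x ≤ M s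
      ∈Y⇒≤M {s} {x} s∈Y = cancel λ t∈X → proj₂ (proj₁ (fM s)) λ s≈r t⟶r →
        proj₁ (Y≐ (f x)) s∈Y t∈X (proj₁ F.⟶-resp (F.sym s≈r) t⟶r)

      -- The hypothesis puts t in the first component generated by s, so t has no arrow to any z
      -- that s has none to.
      J≤⇒↠ : ∀ {s t} → J t ≤ J s → s ↠ t
      J≤⇒↠ {s} Jt≤Js = proj₁ F.fact↠ λ z t⟶z → dne λ s↛z →
        proj₁ (proj₁ (fJ s)) (J≤⇒∈X Jt≤Js)
          (λ s≈r r⟶z → s↛z (proj₂ F.⟶-resp (F.sym s≈r) r⟶z)) t⟶z

      M≤⇒↪ : ∀ {s t} → M s ≤ M t → t ↪ s
      M≤⇒↪ {s} {t} Ms≤Mt = proj₁ F.fact↪ λ z z⟶t → dne λ z↛s →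
        proj₁ (proj₂ (fM s)) (≤M⇒∈Y Ms≤Mt)
          (λ s≈r z⟶r → z↛s (proj₁ F.⟶-resp (F.sym s≈r) z⟶r)) z⟶t

      J-mono : ∀ {s t} → s F.≈ t → J s ≤ J t
      J-mono {s} {t} s≈t = ∈X⇒J≤ (proj₂ (proj₁ (fJ t)) λ b∈ s⟶b → b∈ (F.sym s≈t) s⟶b)

      M-mono : ∀ {s t} → s F.≈ t → M s ≤ M t
      M-mono {s} {t} s≈t = ∈Y⇒≤M (proj₂ (proj₂ (fM s)) λ c∈ c⟶t → c∈ s≈t c⟶t)

      J-cong : ∀ {s t} → s F.≈ t → J s ≈ J t
      J-cong s≈t = antisym (J-mono s≈t) (J-mono (F.sym s≈t))

      M-cong : ∀ {s t} → s F.≈ t → M s ≈ M t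
      M-cong s≈t = antisym (M-mono s≈t) (M-mono (F.sym s≈t))

      J≰M : ∀ {s} → ¬ (J s ≤ M s)
      J≰M {s} Js≤Ms = proj₁ (proj₁ (fM s)) (J≤⇒∈X Js≤Ms) F.refl F.⟶-refl

      -- An arrow s ⟶ b from X(x) to Y(y) factors as s ↠ w ↪ b, and then w is in both.
      separates : ∀ {x y} → ¬ (x ≤ y) → ∃[ w ] (J w ≤ x × y ≤ M w)
      separates {x} {y} x≰y = dne λ ∄w → x≰y (cancel λ s∈X → proj₂ (X≐ (f y)) λ b∈Y s⟶b →
        let (w , s↠w , w↪b) = proj₂ F.mult s⟶b
        in ∄w (w ,
             ∈X⇒J≤ (proj₂ (X≐ (f x)) λ c∈Y w⟶c →
               proj₁ (X≐ (f x)) s∈X c∈Y (proj₂ F.fact↠ s↠w _ w⟶c)) ,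
             ∈Y⇒≤M (proj₂ (Y≐ (f y)) λ c∈X c⟶w →
               proj₁ (Y≐ (f y)) b∈Y c∈X (proj₂ F.fact↪ w↪b _ c⟶w))))

  -- Completely semidistributive lattices

  module _ {ℓ} (L : CompleteLattice ℓ) where
    open CompleteLattice L

    -- Semidistributivity keeps j ∨ u = w for the meet j of `T`, which contains w. If t < j and t ≰
    -- u, then t ∨ u = w would give j ≤ t, so t ∨ u would lie strictly between u and w.
    cover-label : IsCompletelyJoinSemidistributive L → ∀ {u w} → u ⋖ w →
                  ∃[ j ] (IsCompletelyJoinIrreducible L j × j ≤ w × ¬ (j ≤ u) ×
                          w ≤ j ∨ u × (∀ {t} → t < j → t ≤ u))
    cover-label jsd {u} {w} (u<w , ∄) =
      j , isCompletelyJoinIrreducible L j≰u below , j≤w , j≰u , reflexive (Eq.sym ju≈w) , below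
      where
      T : Pred Carrier ℓ
      T t = t ∨ u ≈ w

      j : Carrier
      j = ⋀ T

      ju≈w : j ∨ u ≈ w
      ju≈w = jsd T u w (w , antisym (∨-least L refl (proj₁ u<w)) (x≤x∨y L)) id

      j≤w : j ≤ w
      j≤w = trans (x≤x∨y L) (reflexive ju≈w)

      j≰u : ¬ (j ≤ u)
      j≰u j≤u = <⇒≱ L u<w (trans (reflexive (Eq.sym ju≈w)) (∨-least L j≤u refl))

      below : ∀ {t} → t < j → t ≤ u
      below {t} t<j = dne λ t≰u → ∄ (t ∨ u ,
        ≤∧≱⇒< L (y≤x∨y L) (λ tu≤u → t≰u (trans (x≤x∨y L) tu≤u)) ,
        (∨-least L (trans (proj₁ t<j) j≤w) (proj₁ u<w) ,
         λ tu≈w → <⇒≱ L t<j (proj₁ (⋀-meet T) tu≈w)))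

    -- If x ≰ v, the label of a cover between x ∧ v and x is below x, hence below v, hence below the
    -- bottom of the cover.
    semidistributive⇒join-of-Jiᶜ :
      IsCompletelyJoinSemidistributive L → IsWeaklyAtomic L →
      ∀ x → IsJoin poset (λ j → IsCompletelyJoinIrreducible L j × j ≤ x) x
    semidistributive⇒join-of-Jiᶜ jsd wa x = proj₂ , λ v ub → dne λ x≰v →
      let (u , w , xv≤u , u⋖w , w≤x) =
            wa (≤∧≱⇒< L (x∧y≤x L) (λ x≤xv → x≰v (trans x≤xv (x∧y≤y L))))
          (j , ji , j≤w , j≰u , _) = cover-label jsd u⋖w
          j≤x = trans j≤w w≤x
      in j≰u (trans (∧-greatest L j≤x (ub (ji , j≤x))) xv≤u)

    -- Meet semidistributivity produces m; join semidistributivity enters in showing that j is in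
    -- turn minimal for m.
    semidistributive⇒paired : IsCompletelySemidistributive L →
      ∀ j → IsCompletelyJoinIrreducible L j → ∃[ m ] κ-Paired L j m
    semidistributive⇒paired (jsd , msd) j ji =
      m , (j≰m , below , max) , (j≰m , above ∘ <-dual (dual L) , min)
      where
      e : Carrier
      e = lowerStar L j

      e<j : e < j
      e<j = lowerStar-< L ji

      m : Carrier
      m = ⋁ (λ y → y ∧ j ≈ e)

      mj≈e : m ∧ j ≈ e
      mj≈e = msd (λ y → y ∧ j ≈ e) j e
        (e , antisym (x∧y≤x L) (∧-greatest L refl (proj₁ e<j))) id

      j≰m : ¬ (j ≤ m)
      j≰m j≤m = <⇒≱ L e<j (trans (∧-greatest L j≤m refl) (reflexive mj≈e))

      below : ∀ {x} → x < j → x ≤ m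
      below x<j = trans (<⇒≤lowerStar L ji x<j) (trans (reflexive (Eq.sym mj≈e)) (x∧y≤x L))

      max : ∀ {y} → (∀ {x} → x < j → x ≤ y) → ¬ (j ≤ y) → y ≤ m
      max ub j≰y = proj₁ (⋁-join _) (antisym
        (<⇒≤lowerStar L ji (≤∧≱⇒< L (x∧y≤y L) (λ j≤yj → j≰y (trans j≤yj (x∧y≤x L)))))
        (∧-greatest L (ub e<j) (proj₁ e<j)))

      above : ∀ {y} → m < y → j ≤ y
      above m<y = dne λ j≰y → <⇒≱ L m<y (max (λ x<j → trans (below x<j) (proj₁ m<y)) j≰y)

      -- If j ≰ y then j ∧ y ≤ m, although j ∨ m = y ∨ m forces (j ∧ y) ∨ m = j ∨ m > m.
      min : ∀ {y} → (∀ {x} → CompleteLattice._<_ (dual L) x m → y ≤ x) → ¬ (y ≤ m) → j ≤ y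
      min {y} lb y≰m = dne λ j≰y →
        let jy≤m = below (≤∧≱⇒< L (x∧y≤x L) (λ j≤jy → j≰y (trans j≤jy (x∧y≤y L))))
        in j≰m (trans (x≤x∨y L) (trans (reflexive (Eq.sym jy∨m≈j∨m)) (∨-least L jy≤m refl)))
        where
        m<j∨m : m < j ∨ m
        m<j∨m = ≤∧≱⇒< L (y≤x∨y L) (λ jm≤m → j≰m (trans (x≤x∨y L) jm≤m))

        m<y∨m : m < y ∨ m
        m<y∨m = ≤∧≱⇒< L (y≤x∨y L) (λ ym≤m → y≰m (trans (x≤x∨y L) ym≤m))

        -- Both joins are strictly above m, and y and j lie below everything strictly above m.
        y∨m≈j∨m : y ∨ m ≈ j ∨ m
        y∨m≈j∨m = antisym (∨-least L (lb (<-dual L m<j∨m)) (y≤x∨y L))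
                          (∨-least L (above m<y∨m) (y≤x∨y L))

        jy∨m≈j∨m : (j ∧ y) ∨ m ≈ j ∨ m
        jy∨m≈j∨m = jsd (λ t → t ≈ j ⊎ t ≈ y) m (j ∨ m) (j , inj₁ Eq.refl) λ where
          (inj₁ t≈j) → antisym (∨-monoˡ L (reflexive t≈j)) (∨-monoˡ L (reflexive (Eq.sym t≈j)))
          (inj₂ t≈y) → Eq.trans
            (antisym (∨-monoˡ L (reflexive t≈y)) (∨-monoˡ L (reflexive (Eq.sym t≈y)))) y∨m≈j∨m

  module _ {ℓ} (L : CompleteLattice ℓ) where
    open CompleteLattice L

    semidistributive⇒biSpatial :
      IsCompletelySemidistributive L → IsWeaklyAtomic L → IsBiSpatial L
    semidistributive⇒biSpatial (jsd , msd) wa = record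
      { join-of-Jiᶜ = semidistributive⇒join-of-Jiᶜ L jsd wa
      ; meet-of-Miᶜ = semidistributive⇒join-of-Jiᶜ (dual L) msd (isWeaklyAtomic-dual L wa)
      }

    semidistributive⇒κLattice : IsCompletelySemidistributive L → IsBiSpatial L → IsκLattice L
    semidistributive⇒κLattice (jsd , msd) spatial = isκLattice L spatial
      (semidistributive⇒paired L (jsd , msd))
      (λ m mi → let (j , p) = semidistributive⇒paired (dual L) (msd , jsd) m mi in j , swap p)

    -- A cover u ⋖ v between z₁ ∧ z₂ and z₁ with u ∨ z₂ < v ∨ z₂ has a label j that is
    -- not below u ∨ z₂, so that z₂ ≤ u ∨ z₂ ≤ κ(j).
    semidistributive⇒wellSeparated :
      IsCompletelySemidistributive L → JoinsAndMeetsCoverDetermined L → IsWellSeparatedκLattice L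
    semidistributive⇒wellSeparated sd (jcd , mcd) = K , λ {z₁} {z₂} z₁≰z₂ →
      let (u , v , _ , u⋖v , v≤z₁ , uz<vz) = jcd {z₁ ∧ z₂} {z₁} {z₂}
            (≤∧≱⇒< L (x∧y≤x L) (λ z₁≤z₁z₂ → z₁≰z₂ (trans z₁≤z₁z₂ (x∧y≤y L))))
            (≤∧≱⇒< L (∨-monoˡ L (x∧y≤x L)) (λ h → z₁≰z₂
              (trans (x≤x∨y L) (trans h (∨-least L (x∧y≤y L) refl)))))
          (j , ji , j≤v , _ , v≤ju , below) = cover-label L (proj₁ sd) u⋖v
          (_ , _ , max) = proj₁ (κ-paired L K (j , ji))
      in (j , ji) , trans j≤v v≤z₁ ,
         trans (y≤x∨y L) (max (λ t<j → trans (below t<j) (x≤x∨y L))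
           (λ j≤uz → <⇒≱ L uz<vz
             (∨-least L (trans v≤ju (∨-least L j≤uz (x≤x∨y L))) (y≤x∨y L))))
      where
      K : IsκLattice L
      K = semidistributive⇒κLattice sd (semidistributive⇒biSpatial sd (isWeaklyAtomic L mcd))

  -- Algebraic lattices and Zorn's lemma

  module _ (zorn : ∀ {a} → ZornsLemma a) where

    module _ {ℓ} (L : CompleteLattice ℓ) where
      open CompleteLattice L
      open ListMembership Eq.setoid using () renaming (_∈_ to _∈ₗ_)

      -- A chain is bounded by its join with x: were k below that, compactness would put k below a
      -- finite join, hence below x or a member of the chain.
      maximal-avoiding-compact : ∀ {k x y} → IsCompact L k → x ≤ y → ¬ (k ≤ x) →
        ∃[ u ] (x ≤ u × u ≤ y × ¬ (k ≤ u) × (∀ {w} → u ≤ w → w ≤ y → ¬ (k ≤ w) → w ≤ u))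
      maximal-avoiding-compact {k} {x} {y} compact x≤y k≰x =
        let ((u , x≤u , u≤y , k≰u) , maximal) = zorn P chain-bound
        in u , x≤u , u≤y , k≰u ,
           λ u≤w w≤y k≰w → maximal {_ , trans x≤u u≤w , w≤y , k≰w} u≤w
        where
        Avoids : Pred Carrier ℓ
        Avoids w = x ≤ w × w ≤ y × ¬ (k ≤ w)

        P : Poset ℓ ℓ ℓ
        P = On.poset poset (proj₁ {B = Avoids})

        base : Σ Carrier Avoids
        base = x , refl , x≤y , k≰x

        module _ (C : Pred (Σ Carrier Avoids) ℓ) (chain : IsChain P C) where

          A : Pred Carrier ℓ
          -- Including x keeps the join of an empty chain inside the interval.
          A t = t ≈ x ⊎ ∃[ c ] (c ∈ C × t ≈ proj₁ c)

          finite-bound : ∀ {F} → All A F →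
            ∃[ b ] ((proj₁ b ≈ x ⊎ b ∈ C) × (∀ {t} → t ∈ₗ F → t ≤ proj₁ b))
          finite-bound [] = base , inj₁ Eq.refl , λ ()
          finite-bound (t∈A ∷ F⊆A) with finite-bound F⊆A
          finite-bound (inj₁ t≈x ∷ _) | b , b∈ , bound = b , b∈ , λ where
            (here t′≈t) → trans (reflexive (Eq.trans t′≈t t≈x)) (proj₁ (proj₂ b))
            (there t∈F) → bound t∈F
          finite-bound (inj₂ (c , c∈C , t≈c) ∷ _) | b , inj₁ b≈x , bound = c , inj₂ c∈C , λ where
            (here t′≈t) → reflexive (Eq.trans t′≈t t≈c)
            (there t∈F) → trans (bound t∈F) (trans (reflexive b≈x) (proj₁ (proj₂ c)))
          finite-bound (inj₂ (c , c∈C , t≈c) ∷ _) | b , inj₂ b∈C , bound with chain c∈C b∈C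
          ... | inj₁ c≤b = b , inj₂ b∈C , λ where
            (here t′≈t) → trans (reflexive (Eq.trans t′≈t t≈c)) c≤b
            (there t∈F) → bound t∈F
          ... | inj₂ b≤c = c , inj₂ c∈C , λ where
            (here t′≈t) → reflexive (Eq.trans t′≈t t≈c)
            (there t∈F) → trans (bound t∈F) b≤c

          chain-bound : HasUpperBound P C
          chain-bound =
            (⋁ A , proj₁ (⋁-join A) (inj₁ Eq.refl) ,
             proj₂ (⋁-join A) y (λ where
               (inj₁ t≈x) → trans (reflexive t≈x) x≤y
               (inj₂ (c , _ , t≈c)) → trans (reflexive t≈c) (proj₁ (proj₂ (proj₂ c)))) ,
             λ k≤⋁A →
               let (F , F⊆A , k≤⋁F) = compact A k≤⋁A
                   (b , _ , bound) = finite-bound F⊆A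
               in proj₂ (proj₂ (proj₂ b)) (trans k≤⋁F (proj₂ (⋁-join _) _ bound))) ,
            λ {c} c∈C → proj₁ (⋁-join A) (inj₂ (c , c∈C , Eq.refl))

      compact-separates : IsAlgebraic L → ∀ {x y} → ¬ (x ≤ y) →
                          ∃[ k ] (IsCompact L k × k ≤ x × ¬ (k ≤ y))
      compact-separates alg {x} {y} x≰y = dne λ ∄k → x≰y (proj₂ (alg x) y
        λ {k} (compact , k≤x) → dne λ k≰y → ∄k (k , compact , k≤x , k≰y))

      -- If u is maximal in [x, y] with k ≰ u, then u ⋖ u ∨ k.
      algebraic⇒meetsCoverDetermined : IsAlgebraic L → MeetsCoverDetermined L
      algebraic⇒meetsCoverDetermined alg {x} {y} {z} (x≤y , _) xz<yz =
        let (k , compact , k≤yz , k≰xz) = compact-separates alg (<⇒≱ L xz<yz)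
            k≤y = trans k≤yz (x∧y≤x L)
            k≤z = trans k≤yz (x∧y≤y L)
            (u , x≤u , u≤y , k≰u , maximal) = maximal-avoiding-compact compact x≤y
              (λ k≤x → k≰xz (∧-greatest L k≤x k≤z))
            u∨k≤y = ∨-least L u≤y k≤y
        in u , u ∨ k , x≤u ,
           (≤∧≱⇒< L (x≤x∨y L) (λ uk≤u → k≰u (trans (y≤x∨y L) uk≤u)) ,
            λ (w , u<w , w<uk) → <⇒≱ L u<w (maximal (proj₁ u<w) (trans (proj₁ w<uk) u∨k≤y)
              (λ k≤w → <⇒≱ L w<uk (∨-least L (proj₁ u<w) k≤w)))) ,
           u∨k≤y ,
           ≤∧≱⇒< L (∧-monoˡ L (x≤x∨y L))
             (λ h → k≰u (trans (∧-greatest L (y≤x∨y L) k≤z) (trans h (x∧y≤x L))))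

      algebraic⇒meet-of-Miᶜ : IsAlgebraic L →
        ∀ x → IsMeet poset (λ m → IsCompletelyMeetIrreducible L m × x ≤ m) x
      algebraic⇒meet-of-Miᶜ alg x = proj₂ , λ v lb → dne λ v≰x →
        let (k , compact , k≤v , k≰x) = compact-separates alg v≰x
            (m , x≤m , _ , k≰m , maximal) =
              -- With the top element as y, everything strictly above m is above k, which makes m
              -- completely meet-irreducible.
              maximal-avoiding-compact {y = ⋁ (λ _ → ⊤)} compact (proj₁ (⋁-join _) _) k≰x
            mi = isCompletelyJoinIrreducible (dual L) k≰m
              (λ x<m → dne λ k≰w → <⇒≱ (dual L) x<m
                (maximal (proj₁ x<m) (proj₁ (⋁-join _) _) k≰w))
        in k≰m (trans k≤v (lb (mi , x≤m)))

    module _ {ℓ} (L : CompleteLattice ℓ) where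

      biAlgebraic⇒coverDetermined : IsBiAlgebraic L → JoinsAndMeetsCoverDetermined L
      biAlgebraic⇒coverDetermined (alg , algᵈ) =
        joinsCoverDetermined L (algebraic⇒meetsCoverDetermined (dual L) algᵈ) ,
        algebraic⇒meetsCoverDetermined L alg

      -- The halves cross over: compact elements yield meet-irreducibles, so the join-irreducibles
      -- come from algebraicity of the dual.
      biAlgebraic⇒biSpatial : IsBiAlgebraic L → IsBiSpatial L
      biAlgebraic⇒biSpatial (alg , algᵈ) = record
        { join-of-Jiᶜ = algebraic⇒meet-of-Miᶜ (dual L) algᵈ
        ; meet-of-Miᶜ = algebraic⇒meet-of-Miᶜ L alg
        }

theorem3p1 :
    (∀ {a} → ExcludedMiddle a) →
    (∀ {a} → ZornsLemma a) →
    ∀ {ℓ} (L : CompleteLattice ℓ) →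
      (IsPairsOfTwoAcyclic L ⇔ IsWellSeparatedκLattice L)
    × (IsWellSeparatedκLattice L → IsκLattice L)
    × (IsPairsOfTwoAcyclic L → JoinsAndMeetsCoverDetermined L)
    × (JoinsAndMeetsCoverDetermined L → IsWeaklyAtomic L)
    × (IsκLattice L → IsBiSpatial L)
    × (IsBiAlgebraic L → JoinsAndMeetsCoverDetermined L)
    × (IsBiAlgebraic L → IsBiSpatial L)
    × (IsCompletelySemidistributive L →
          (JoinsAndMeetsCoverDetermined L → IsPairsOfTwoAcyclic L)
        × (IsWeaklyAtomic L → IsBiSpatial L)
        × (IsBiSpatial L → IsκLattice L))
theorem3p1 em zorn L =
  mk⇔ (family⇒wellSeparated em ∘ pairs⇒family em L)
      (family⇒pairs em ∘ wellSeparated⇒family em) ,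
  proj₁ ,
  family⇒coverDetermined em ∘ pairs⇒family em L ,
  isWeaklyAtomic L ∘ proj₂ ,
  IsκLattice.isBiSpatial ,
  biAlgebraic⇒coverDetermined em zorn L ,
  biAlgebraic⇒biSpatial em zorn L ,
  λ sd →
    family⇒pairs em ∘ wellSeparated⇒family em ∘ semidistributive⇒wellSeparated em L sd ,
    semidistributive⇒biSpatial em L sd ,
    semidistributive⇒κLattice em L sd
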